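{- Let $\mathcal{H}=(V,\mathcal{E})$ and $\mathcal{H}'=(V',\mathcal{E}')$ be two hypergraphs with $V=\{1,\dots,n\}$ and $V'=\{1,\dots,m\}$. Then $\mathcal{H}\preceq\mathcal{H}'$ if and only if $f_{\mathcal{H}}\le f_{\mathcal{H}'}$.
   Context: A hypergraph is a pair $\mathcal{H}=(V,\mathcal{E})$ with $V$ a finite nonempty set and $\mathcal{E}$ a set of subsets of $V$ (the empty set is allowed as a hyperedge). A map $h':V'\to V$ is a quotient map from $\mathcal{H}'=(V',\mathcal{E}')$ to $\mathcal{H}=(V,\mathcal{E})$ if for every $E\subseteq V$: $E\in\mathcal{E}$ if and only if the number of $E'\in\mathcal{E}'$ with $h'(E')=E$ (image set) is odd. $\mathcal{H}\preceq\mathcal{H}'$ means there is a quotient map from $\mathcal{H}'$ to $\mathcal{H}$. For a hypergraph $\mathcal{H}=(V,\mathcal{E})$ with $V=\{1,\dots,n\}$, $f_{\mathcal{H}}:\{0,1\}^n\to\{0,1\}$ is the Boolean function given by evaluating over $GF(2)=\{0,1\}$ the polynomial $P_{\mathcal{H}}=\sum_{E\in\mathcal{E}}\prod_{i\in E}x_i$. For Boolean functions $g:\{0,1\}^n\to\{0,1\}$ and $f:\{0,1\}^m\to\{0,1\}$, $g\le f$ ($g$ is a simple minor of $f$) means that there is a map $\sigma:\{1,\dots,m\}\to\{1,\dots,n\}$ with $g(x_1,\dots,x_n)=f(x_{\sigma(1)},\dots,x_{\sigma(m)})$. -}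

module Defs where

open import Data.Bool using (Bool; true; false; _xor_; _≟_)
open import Data.Bool.ListAction using (and)
open import Data.Fin using (Fin)
import Data.Fin.Properties as Fin
open import Data.Fin.Subset using (Subset; _∈_)
open import Data.Fin.Subset.Properties using (_∈?_)
open import Data.List using (List; allFin; filter; foldr; length; map)
import Data.List.Membership.Propositional as List
open import Data.List.Relation.Unary.Unique.Propositional using (Unique)
open import Data.Nat using (ℕ; NonZero; parity)
open import Data.Parity using (1ℙ)
open import Data.Product using (∃)
open import Data.Vec using (Vec; lookup; tabulate)
open import Data.Vec.Properties using (≡-dec)
open import Function using (_⇔_)
open import Relation.Binary using (DecidableEquality)
open import Relation.Binary.PropositionalEquality using (_≡_)
open import Relation.Nullary.Decidable using (does; _×-dec_)

private
  variable
    m n : ℕ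

Odd : ℕ → Set
Odd k = parity k ≡ 1ℙ

-- The vertex set {1,…,n} is Fin n.  The set of hyperedges is given by a
-- duplicate-free enumeration; no definition below depends on its order.
record Hypergraph (n : ℕ) : Set where
  field
    nonempty : NonZero n
    edges    : List (Subset n)
    unique   : Unique edges

open Hypergraph public

infix 4 _∈ᴱ_ _≟ˢ_ _≼_ _≤ᵐ_

_∈ᴱ_ : Subset n → Hypergraph n → Set
E ∈ᴱ H = E List.∈ edges H

_≟ˢ_ : DecidableEquality (Subset n)
_≟ˢ_ = ≡-dec _≟_

image : (Fin m → Fin n) → Subset m → Subset n
image h S = tabulate λ j → does (Fin.any? λ i → (i ∈? S) ×-dec (h i Fin.≟ j))

fibreSize : (Fin m → Fin n) → Hypergraph m → Subset n → ℕ
fibreSize h H′ E = length (filter (λ E′ → image h E′ ≟ˢ E) (edges H′))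

IsQuotientMap : Hypergraph m → Hypergraph n → (Fin m → Fin n) → Set
IsQuotientMap H′ H h = ∀ E → E ∈ᴱ H ⇔ Odd (fibreSize h H′ E)

_≼_ : Hypergraph n → Hypergraph m → Set
H ≼ H′ = ∃ λ h → IsQuotientMap H′ H h

BoolFun : ℕ → Set
BoolFun n = Vec Bool n → Bool

-- GF(2) is Bool, with _xor_ as addition and _∧_ as multiplication.

monomial : Subset n → BoolFun n
monomial {n} E x = and (map (lookup x) (filter (_∈? E) (allFin n)))

⟦_⟧ : Hypergraph n → BoolFun n
⟦ H ⟧ x = foldr _xor_ false (map (λ E → monomial E x) (edges H))

_≤ᵐ_ : BoolFun n → BoolFun m → Set
_≤ᵐ_ {n} {m} g f =
  ∃ λ (σ : Fin m → Fin n) → ∀ x → g x ≡ f (tabulate λ i → lookup x (σ i))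

{-# OPTIONS --safe #-}

-- Substituting x ∘ h into the monomial of E′ gives the monomial of the image of
-- E′ under h, so f_H′ (x ∘ h) is the polynomial whose coefficient at E is the
-- parity of the fibre over E.  Hence h is a quotient map iff this polynomial and
-- P_H have the same coefficients.  A multilinear polynomial over GF(2) is
-- determined by its values, because the passage from coefficients to values,
-- a ↦ (x ↦ Σ_{E ⊆ x} a E), is an involution in characteristic 2.
module Submission where

open import Defs
open import Algebra.Bundles using (CommutativeRing)
open import Algebra.Properties.CommutativeSemigroup using (interchange)
open import Data.Bool using (Bool; true; false; not; _xor_)
open import Data.Bool.ListAction using (and)
open import Data.Bool.Properties
  using (⇔→≡; xor-assoc; xor-same; xor-identityʳ; xor-∧-commutativeRing)
open import Data.Fin using (Fin)
import Data.Fin.Properties as Fin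
open import Data.Fin.Subset using (Subset; _∈_; _⊆_)
open import Data.Fin.Subset.Properties using (_∈?_; _⊆?_)
open import Data.List using (List; []; _∷_; allFin; filter; foldr; length; map)
import Data.List.Membership.Propositional as List
open import Data.List.Membership.Propositional.Properties
  using (∈-allFin; ∈-filter⁺; ∈-filter⁻)
import Data.List.Relation.Unary.All as All
open import Data.List.Relation.Unary.AllPairs using ([]; _∷_)
open import Data.List.Relation.Unary.Any using (here; there)
open import Data.List.Relation.Unary.Unique.Propositional using (Unique)
open import Data.Nat using (ℕ; zero; suc; parity)
open import Data.Parity using (1ℙ)
import Data.Parity.Properties as ℙ
open import Data.Product using (_,_; proj₂)
open import Data.Vec using ([]; _∷_; lookup; tabulate)
open import Data.Vec.Properties using ([]=⇒lookup; lookup⇒[]=; lookup∘tabulate)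
open import Function using (_⇔_; mk⇔; Equivalence; _∘_; const; id)
open import Function.Construct.Composition using (_⇔-∘_)
open import Function.Properties.Equivalence using () renaming (sym to ⇔-sym)
open import Relation.Binary.PropositionalEquality
  using (_≡_; _≗_; refl; sym; trans; cong; cong₂; subst; module ≡-Reasoning)
open import Relation.Nullary using (Dec; yes; no; does; contradiction)
open import Relation.Nullary.Decidable using (does-⇔; _×-dec_)
open import Relation.Unary using (Decidable)

open Equivalence using (to; from)
open ≡-Reasoning

private
  variable
    m n : ℕ
    A : Set

does≡true⇔ : (a? : Dec A) → does a? ≡ true ⇔ A
does≡true⇔ (yes a) = mk⇔ (const a) (const refl)
does≡true⇔ (no ¬a) = mk⇔ (λ ()) (λ a → contradiction a ¬a)

∈⇔lookup : ∀ {i} (S : Subset n) → i ∈ S ⇔ lookup S i ≡ true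
∈⇔lookup {i = i} S = mk⇔ []=⇒lookup (lookup⇒[]= i S)

∈-tabulate⇔ : ∀ (f : Fin n → Bool) {i} → i ∈ tabulate f ⇔ f i ≡ true
∈-tabulate⇔ f {i} =
  mk⇔ (trans (sym (lookup∘tabulate f i))) (trans (lookup∘tabulate f i))
  ⇔-∘ ∈⇔lookup (tabulate f)

and-map⇔ : (f : A → Bool) (xs : List A) →
           and (map f xs) ≡ true ⇔ (∀ {a} → a List.∈ xs → f a ≡ true)
and-map⇔ f []       = mk⇔ (λ _ ()) (const refl)
and-map⇔ f (x ∷ xs) with f x in fx
... | true  = mk⇔ (λ { eq (here refl) → fx ; eq (there a∈) → to (and-map⇔ f xs) eq a∈ })
                  (λ all → from (and-map⇔ f xs) (λ a∈ → all (there a∈)))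
... | false = mk⇔ (λ ()) (λ all → trans (sym fx) (all (here refl)))

-- A point of the cube is identified with the set of its ones, and a product over GF(2) is 1 only if
-- all its factors are.
monomial≡⊆? : (E x : Subset n) → monomial E x ≡ does (E ⊆? x)
monomial≡⊆? {n} E x = ⇔→≡ (⇔-sym (does≡true⇔ (E ⊆? x)) ⇔-∘ (all-⊆ ⇔-∘ and-map⇔ _ _))
  where
  all-⊆ : (∀ {i} → i List.∈ filter (_∈? E) (allFin n) → lookup x i ≡ true) ⇔ E ⊆ x
  all-⊆ = mk⇔
    (λ all {i} i∈E → lookup⇒[]= i x (all (∈-filter⁺ (_∈? E) (∈-allFin i) i∈E)))
    (λ E⊆x {i} i∈ → []=⇒lookup (E⊆x (proj₂ (∈-filter⁻ (_∈? E) {xs = allFin n} i∈))))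

-- The substituted point is the preimage of `x` under `h`, so this is the adjunction between image
-- and preimage.
image-⊆⇔ : ∀ (h : Fin m → Fin n) {S : Subset m} {x : Subset n} →
           S ⊆ tabulate (lookup x ∘ h) ⇔ image h S ⊆ x
image-⊆⇔ h {S} {x} = mk⇔ ⇒ ⇐
  where
  ∈image⇔ : ∀ {j} → j ∈ image h S ⇔ _
  ∈image⇔ {j} =
    does≡true⇔ (Fin.any? λ i → (i ∈? S) ×-dec (h i Fin.≟ j)) ⇔-∘ ∈-tabulate⇔ _

  ⇒ : S ⊆ tabulate (lookup x ∘ h) → image h S ⊆ x
  ⇒ S⊆ {j} j∈ with to ∈image⇔ j∈
  ... | i , i∈S , refl = lookup⇒[]= (h i) x (to (∈-tabulate⇔ (lookup x ∘ h)) (S⊆ i∈S))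

  ⇐ : image h S ⊆ x → S ⊆ tabulate (lookup x ∘ h)
  ⇐ im⊆ {i} i∈S =
    from (∈-tabulate⇔ (lookup x ∘ h)) ([]=⇒lookup (im⊆ (from ∈image⇔ (i , i∈S , refl))))

-- Vertices of `S` with the same value under `h` contribute a single variable, because y·y = y in
-- GF(2); `image` forgets multiplicities in the same way.
monomial-∘ : (h : Fin m → Fin n) (S : Subset m) (x : Subset n) →
             monomial S (tabulate (lookup x ∘ h)) ≡ monomial (image h S) x
monomial-∘ h S x = begin
  monomial S (tabulate (lookup x ∘ h))   ≡⟨ monomial≡⊆? S _ ⟩
  does (S ⊆? tabulate (lookup x ∘ h))    ≡⟨ does-⇔ (image-⊆⇔ h) (S ⊆? _) (image h S ⊆? x) ⟩
  does (image h S ⊆? x)                  ≡⟨ monomial≡⊆? (image h S) x ⟨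
  monomial (image h S) x                 ∎

xorSum : (A → Bool) → List A → Bool
xorSum f xs = foldr _xor_ false (map f xs)

xorSum-cong : {f g : A → Bool} → f ≗ g → xorSum f ≗ xorSum g
xorSum-cong f≗g []       = refl
xorSum-cong f≗g (x ∷ xs) = cong₂ _xor_ (f≗g x) (xorSum-cong f≗g xs)

isOdd : ℕ → Bool
isOdd k = does (parity k ℙ.≟ 1ℙ)

isOdd-suc : ∀ k → not (isOdd k) ≡ isOdd (suc k)
isOdd-suc zero          = refl
isOdd-suc (suc zero)    = refl
isOdd-suc (suc (suc k)) = isOdd-suc k

-- Addition in GF(2) counts modulo 2, which ties fibre sizes to coefficients.
xorSum-does : ∀ {P : A → Set} (P? : Decidable P) xs →
              xorSum (does ∘ P?) xs ≡ isOdd (length (filter P? xs))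
xorSum-does P? []       = refl
xorSum-does P? (x ∷ xs) with does (P? x)
... | true  = trans (cong not (xorSum-does P? xs)) (isOdd-suc (length (filter P? xs)))
... | false = xorSum-does P? xs

-- The list xs with the map g stands for the polynomial Σ_{a ∈ xs} ∏_{i ∈ g a} xᵢ,
-- in which several a may contribute the same monomial.
coefficient : (A → Subset n) → List A → Subset n → Bool
coefficient g xs E = xorSum (λ a → does (g a ≟ˢ E)) xs

evaluate : (A → Subset n) → List A → BoolFun n
evaluate g xs x = xorSum (λ a → monomial (g a) x) xs

-- zeta a x = Σ_{E ⊆ x} a E over GF(2), by recursion on the ground set.
zeta : (Subset n → Bool) → Subset n → Bool
zeta a []          = a []
zeta a (false ∷ x) = zeta (a ∘ (false ∷_)) x
zeta a (true ∷ x)  = zeta (a ∘ (false ∷_)) x xor zeta (a ∘ (true ∷_)) x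

zeta-cong : {a b : Subset n → Bool} → a ≗ b → zeta a ≗ zeta b
zeta-cong a≗b []          = a≗b []
zeta-cong a≗b (false ∷ x) = zeta-cong (a≗b ∘ (false ∷_)) x
zeta-cong a≗b (true ∷ x)  =
  cong₂ _xor_ (zeta-cong (a≗b ∘ (false ∷_)) x) (zeta-cong (a≗b ∘ (true ∷_)) x)

-- With `zeta-false` this is linearity. It serves the cancellation in `zeta-involutive` and the
-- induction over monomials in `zeta-coefficient`.
zeta-xor : (a b : Subset n → Bool) (x : Subset n) →
           zeta (λ E → a E xor b E) x ≡ zeta a x xor zeta b x
zeta-xor a b []          = refl
zeta-xor a b (false ∷ x) = zeta-xor (a ∘ (false ∷_)) (b ∘ (false ∷_)) x
zeta-xor a b (true ∷ x)  = trans
  (cong₂ _xor_ (zeta-xor (a ∘ (false ∷_)) (b ∘ (false ∷_)) x)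
               (zeta-xor (a ∘ (true ∷_)) (b ∘ (true ∷_)) x))
  (interchange (CommutativeRing.+-commutativeSemigroup xor-∧-commutativeRing)
    (zeta (a ∘ (false ∷_)) x) (zeta (b ∘ (false ∷_)) x)
    (zeta (a ∘ (true ∷_)) x) (zeta (b ∘ (true ∷_)) x))

zeta-false : (x : Subset n) → zeta (const false) x ≡ false
zeta-false []          = refl
zeta-false (false ∷ x) = zeta-false x
zeta-false (true ∷ x)  = cong₂ _xor_ (zeta-false x) (zeta-false x)

-- In one coordinate the transform is the matrix with rows (1, 0) and (1, 1), whose square is the
-- identity modulo 2: the term `zeta (zeta a₀) x` occurs twice and cancels.
zeta-involutive : (a : Subset n → Bool) → zeta (zeta a) ≗ a
zeta-involutive a []          = refl
zeta-involutive a (false ∷ x) = zeta-involutive (a ∘ (false ∷_)) x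
zeta-involutive a (true ∷ x)  = begin
  zeta (zeta a₀) x xor zeta (λ E → zeta a₀ E xor zeta a₁ E) x
    ≡⟨ cong (zeta (zeta a₀) x xor_) (zeta-xor (zeta a₀) (zeta a₁) x) ⟩
  zeta (zeta a₀) x xor (zeta (zeta a₀) x xor zeta (zeta a₁) x)
    ≡⟨ xor-assoc (zeta (zeta a₀) x) _ _ ⟨
  (zeta (zeta a₀) x xor zeta (zeta a₀) x) xor zeta (zeta a₁) x
    ≡⟨ cong (_xor zeta (zeta a₁) x) (xor-same (zeta (zeta a₀) x)) ⟩
  zeta (zeta a₁) x
    ≡⟨ zeta-involutive a₁ x ⟩
  a₁ x ∎
  where
  a₀ = a ∘ (false ∷_)
  a₁ = a ∘ (true ∷_)

zeta-injective : {a b : Subset n → Bool} → zeta a ≗ zeta b → a ≗ b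
zeta-injective {a = a} {b} eq E =
  trans (sym (zeta-involutive a E)) (trans (zeta-cong eq E) (zeta-involutive b E))

-- The coefficients at sets whose first entry differs from that of `F` are constantly `false`, so
-- each coordinate keeps at most one half of the sum.
zeta-singleton : (F x : Subset n) → zeta (λ E → does (F ≟ˢ E)) x ≡ does (F ⊆? x)
zeta-singleton []          []          = refl
zeta-singleton (false ∷ F) (false ∷ x) = zeta-singleton F x
zeta-singleton (false ∷ F) (true ∷ x)  =
  trans (cong₂ _xor_ (zeta-singleton F x) (zeta-false x)) (xor-identityʳ _)
zeta-singleton (true ∷ F)  (false ∷ x) = zeta-false x
zeta-singleton (true ∷ F)  (true ∷ x)  = cong₂ _xor_ (zeta-false x) (zeta-singleton F x)

-- By linearity a single monomial suffices, and that is `zeta-singleton`; repeated monomials add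
-- modulo 2 on both sides.
zeta-coefficient : (g : A → Subset n) (xs : List A) →
                   zeta (coefficient g xs) ≗ evaluate g xs
zeta-coefficient g []       x = zeta-false x
zeta-coefficient g (a ∷ as) x = trans
  (zeta-xor (λ E → does (g a ≟ˢ E)) (coefficient g as) x)
  (cong₂ _xor_ (trans (zeta-singleton (g a) x) (sym (monomial≡⊆? (g a) x)))
               (zeta-coefficient g as x))

-- Duplicate-freeness enters here: a set listed twice would have coefficient 0.
coefficient⇔∈ : ∀ {xs : List (Subset n)} → Unique xs →
                ∀ E → coefficient id xs E ≡ true ⇔ E List.∈ xs
coefficient⇔∈ []                E = mk⇔ (λ ()) (λ ())
coefficient⇔∈ {xs = F ∷ xs} (F∉xs ∷ !xs) E with F ≟ˢ E
... | no F≢E   = mk⇔ (there ∘ to (coefficient⇔∈ !xs E))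
                     (λ { (here E≡F)  → contradiction (sym E≡F) F≢E
                        ; (there E∈xs) → from (coefficient⇔∈ !xs E) E∈xs })
... | yes refl with coefficient id xs E in eq
...   | false = mk⇔ (const (here refl)) (const refl)
-- The tail would contain the head `F` again.
...   | true  = contradiction refl (All.lookup F∉xs (to (coefficient⇔∈ !xs E) eq))

coefficient⇔Odd : (h : Fin m → Fin n) (H′ : Hypergraph m) →
                  ∀ E → coefficient (image h) (edges H′) E ≡ true ⇔ Odd (fibreSize h H′ E)
coefficient⇔Odd h H′ E =
  subst (λ b → b ≡ true ⇔ Odd (fibreSize h H′ E))
        (sym (xorSum-does (λ E′ → image h E′ ≟ˢ E) (edges H′)))
        (does≡true⇔ (parity (fibreSize h H′ E) ℙ.≟ 1ℙ))

-- Two Booleans are equal when being `true` is equivalent for them, so the parity condition at each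
-- `E` amounts to equality of the coefficients there.
quotient⇔coefficients :
  (H : Hypergraph n) (H′ : Hypergraph m) (h : Fin m → Fin n) →
  IsQuotientMap H′ H h ⇔ coefficient id (edges H) ≗ coefficient (image h) (edges H′)
quotient⇔coefficients H H′ h = mk⇔
  (λ q E → ⇔→≡ (⇔-sym (odd E) ⇔-∘ (q E ⇔-∘ edge E)))
  (λ eq E → subst (λ b → b ≡ true ⇔ Odd (fibreSize h H′ E)) (sym (eq E)) (odd E) ⇔-∘ ⇔-sym (edge E))
  where
  edge = coefficient⇔∈ (unique H)
  odd  = coefficient⇔Odd h H′

-- One direction applies `zeta` to both coefficient functions, the other uses its injectivity.
coefficients⇔minor :
  (H : Hypergraph n) (H′ : Hypergraph m) (h : Fin m → Fin n) →
  coefficient id (edges H) ≗ coefficient (image h) (edges H′) ⇔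
  (∀ x → ⟦ H ⟧ x ≡ ⟦ H′ ⟧ (tabulate λ i → lookup x (h i)))
coefficients⇔minor H H′ h = mk⇔
  (λ eq x → trans (sym (value x)) (trans (zeta-cong eq x) (value′ x)))
  (λ eq → zeta-injective λ x → trans (value x) (trans (eq x) (sym (value′ x))))
  where
  value : zeta (coefficient id (edges H)) ≗ ⟦ H ⟧
  value = zeta-coefficient id (edges H)

  value′ : ∀ x → zeta (coefficient (image h) (edges H′)) x ≡ ⟦ H′ ⟧ (tabulate (lookup x ∘ h))
  value′ x = trans (zeta-coefficient (image h) (edges H′) x)
                   (xorSum-cong (λ S → sym (monomial-∘ h S x)) (edges H′))

theorem10 : ∀ {n m : ℕ} (H : Hypergraph n) (H′ : Hypergraph m) → (H ≼ H′) ⇔ (⟦ H ⟧ ≤ᵐ ⟦ H′ ⟧)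
-- The quotient map and the substitution σ are the same function `h`, so the two notions are
-- compared for each `h` separately.
theorem10 H H′ = mk⇔ (λ (h , q) → h , to (equiv h) q) (λ (h , q) → h , from (equiv h) q)
  where
  equiv = λ h → coefficients⇔minor H H′ h ⇔-∘ quotient⇔coefficients H H′ h
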